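{- For every parallel pushdown automaton $M$ with exactly one state there is a finite weakly guarded recursive specification $\Gamma$ over $\mathrm{BPP}^{\mathbf{0}\mathbf{1}}_{\theta}$ (with a designated initial identifier) such that the process graph of $\Gamma$ and the process graph $\mathcal{P}(M)$ of $M$ are divergence-preserving branching bisimilar.
   Context: **Labelled transition systems and process graphs.** A labelled transition system is a tuple $(\mathcal{S},\mathcal{A},\rightarrow,\downarrow)$ with $\mathcal{S}$ a set of states, $\mathcal{A}$ a set of actions, $\tau\notin\mathcal{A}$ the silent action, $\rightarrow\,\subseteq\mathcal{S}\times(\mathcal{A}\cup\{\tau\})\times\mathcal{S}$ the transition relation, and $\downarrow\,\subseteq\mathcal{S}$ the set of accepting (final) states; write $s\xrightarrow{a}s'$ and $s\downarrow$. A process graph is a labelled transition system with a designated root state. Write $s\Rightarrow t$ if $t$ can be reached from $s$ by zero or more $\tau$-transitions, $s\Rightarrow^{+}t$ if by one or more, and $s\xrightarrow{(a)}t$ if $s\xrightarrow{a}t$, or $a=\tau$ and $s=t$. **Divergence-preserving branching bisimilarity.** A symmetric relation $R$ on $\mathcal{S}$ is a branching bisimulation if for all $s\mathrel{R}t$ and $a\in\mathcal{A}\cup\{\tau\}$: (1) if $s\xrightarrow{a}s'$ then there are $t'',t'$ with $t\Rightarrow t''\xrightarrow{(a)}t'$, $s\mathrel{R}t''$ and $s'\mathrel{R}t'$; (2) if $s\downarrow$ then there is $t'$ with $t\Rightarrow t'$ and $t'\downarrow$. It is divergence-preserving if for all $s,t$, whenever there is an infinite sequence $s=s_0\xrightarrow{\tau}s_1\xrightarrow{\tau}s_2\cdots$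 with $s_i\mathrel{R}t$ for all $i\geq 0$, there is $t'$ with $t\Rightarrow^{+}t'$ and $s_i\mathrel{R}t'$ for some $i\geq 0$. States $s,t$ are divergence-preserving branching bisimilar if some divergence-preserving branching bisimulation relates them. Two process graphs are divergence-preserving branching bisimilar if their roots are, in the disjoint union of the two underlying labelled transition systems (over the union of their action sets). **Parallel pushdown automata.** $\mathcal{D}^{\{\!\{\,\}\!\}}$ is the set of finite multisets (bags) over $\mathcal{D}$, $\cup$ on bags is multiset sum, and $\mathcal{D}^{\pm}=\{+d\mid d\in\mathcal{D}\}\cup\{ -d\mid d\in\mathcal{D}\}$ (two disjoint copies of $\mathcal{D}$). A parallel pushdown automaton is a tuple $M=(\mathcal{S},\mathcal{A},\mathcal{D},\rightarrow,\uparrow,\downarrow)$ with $\mathcal{S}$ a finite set of states, $\mathcal{A}$ a finite input alphabet ($\tau\notin\mathcal{A}$), $\mathcal{D}$ a finite data alphabet, $\rightarrow\,\subseteq\mathcal{S}\times(\mathcal{A}\cup\{\tau\})\times\mathcal{D}^{\pm}\times\mathcal{D}^{\{\!\{\,\}\!\}}\times\mathcal{S}$ a finite set of transitions, $\uparrow\,\in\mathcal{S}$ the initial state, and $\downarrow\,\subseteq\mathcal{S}$ the accepting states. Write $s\xrightarrow{a[+d/x]}t$ for $(s,a,+d,x,t)\in\,\rightarrow$, and $s\xrightarrow{a[-d/x]}t$ for $(s,a,-d,x,t)\in\,\rightarrow$. The process graph $\mathcal{P}(M)$ has states $(s,x)$ with $s\in\mathcal{S}$, $x\in\mathcal{D}^{\{\!\{\,\}\!\}}$;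 root $(\uparrow,\emptyset)$; accepting states all $(s,x)$ with $s\in\,\downarrow$; and exactly the transitions $(s,\{\!\{d\}\!\}\cup x)\xrightarrow{a}(s',x'\cup x)$ whenever $s\xrightarrow{a[+d/x']}s'$, and $(s,x)\xrightarrow{a}(s',x'\cup x)$ whenever there is $d\notin x$ with $s\xrightarrow{a[-d/x']}s'$. **Process algebra $\mathrm{BPP}^{\mathbf{0}\mathbf{1}}_{\theta}$.** Let $\mathcal{A}$ be a set of actions, $\tau\notin\mathcal{A}$ the silent action, and $\mathcal{P}$ a finite set of process identifiers. Let $<$ be a (strict) partial ordering on $\mathcal{A}\cup\{\tau\}$ (the priority ordering; $a<b$ means $a$ has lower priority than $b$) such that $\tau<a$ never holds, and whenever $a<b$ then also $a<\tau$ for $a\in\mathcal A$, $b\in\mathcal A\cup\{\tau\}$. The set $\mathcal{A}$ (which may contain auxiliary actions) and the ordering $<$ are parameters of the algebra, and giving a specification includes choosing them. Process expressions are generated by $p::=\mathbf{0}\mid\mathbf{1}\mid a.p\mid p+p\mid p\parallel p\mid X\mid\theta(p)\mid\rho_f(p)$ with $a\in\mathcal{A}\cup\{\tau\}$, $X\in\mathcal{P}$, and $f$ any function on $\mathcal{A}\cup\{\tau\}$ with $f(\tau)=\tau$ ($\theta$ is the priority operator, $\rho_f$ a renaming operator). A (finite) recursive specification $\Gamma$ assigns to every $X\in\mathcal{P}$ exactly one defining equation $X\stackrel{\mathrm{def}}{=}p$ with $p$ a process expression. It is weakly guarded if every occurrence of a process identifier in the right-hand side of a defining equation is within the scope of an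 action prefix $a.\_$ with $a\in\mathcal{A}\cup\{\tau\}$. The transitions and acceptance of process expressions relative to $\Gamma$ are determined by the following rules: $\mathbf{1}\downarrow$; $a.p\xrightarrow{a}p$; if $p\downarrow$ or $q\downarrow$ then $(p+q)\downarrow$; if $p\xrightarrow{a}p'$ then $p+q\xrightarrow{a}p'$ and $q+p\xrightarrow{a}p'$; if $p\downarrow$ and $q\downarrow$ then $(p\parallel q)\downarrow$; if $p\xrightarrow{a}p'$ then $p\parallel q\xrightarrow{a}p'\parallel q$ and $q\parallel p\xrightarrow{a}q\parallel p'$; if $X\stackrel{\mathrm{def}}{=}p$ and $p\xrightarrow{a}p'$ then $X\xrightarrow{a}p'$; if $X\stackrel{\mathrm{def}}{=}p$ and $p\downarrow$ then $X\downarrow$; if $p\downarrow$ then $\theta(p)\downarrow$ and $\rho_f(p)\downarrow$; if $p\xrightarrow{a}p'$ and for all $b>a$ there is no $p''$ with $p\xrightarrow{b}p''$, then $\theta(p)\xrightarrow{a}\theta(p')$; if $p\xrightarrow{a}p'$ then $\rho_f(p)\xrightarrow{f(a)}\rho_f(p')$. (For weakly guarded specifications the rules, including the one with a negative premise, determine a unique transition relation.) The process graph of $\Gamma$ is this labelled transition system with the initial identifier as root. -}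

module Defs where

open import Level using (0ℓ)
open import Data.Empty using (⊥)
open import Data.Fin.Base using (Fin)
open import Data.Fin.Subset using (Subset; _∈_)
open import Data.List.Base using (List)
import Data.List.Membership.Propositional as List
open import Data.Nat.Base using (ℕ; suc; _+_)
open import Data.Product.Base using (∃; ∃-syntax; Σ-syntax; _×_; _,_; proj₁; proj₂; map₂)
open import Data.Unit.Base using (⊤; tt)
open import Data.Sum.Base as Sum using (_⊎_; inj₁; inj₂; [_,_])
open import Data.Sum.Relation.Binary.Pointwise using (Pointwise)
open import Data.Vec.Base using (Vec; replicate; zipWith; lookup; _[_]≔_)
open import Function.Base using (id; _∘_; const)
open import Function.Bundles using (_⇔_; mk⇔; Equivalence; _↣_; Injection)
open import Relation.Binary.Construct.Closure.ReflexiveTransitive using (Star)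
open import Relation.Binary.Construct.Closure.Transitive using (TransClosure)
open import Relation.Binary.Core using (Rel)
open import Relation.Binary.Definitions using (Symmetric)
open import Relation.Binary.Structures using (IsStrictPartialOrder)
open import Relation.Binary.PropositionalEquality.Core using (_≡_; refl)
open import Relation.Nullary.Negation.Core using (¬_)

data Act (A : Set) : Set where
  τ   : Act A
  act : A → Act A

mapAct : {A B : Set} → (A → B) → Act A → Act B
mapAct f τ       = τ
mapAct f (act a) = act (f a)

record LTS (A : Set) : Set₁ where
  infix 4 _─[_]→_ _─[⦅_⦆]→_ _⇒_ _⇒⁺_
  infix 5 _↓
  field
    State   : Set
    _─[_]→_ : State → Act A → State → Set
    _↓      : State → Set

  _─τ→_ : Rel State 0ℓ
  s ─τ→ t = s ─[ τ ]→ t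

  _⇒_ : Rel State 0ℓ
  _⇒_ = Star _─τ→_

  _⇒⁺_ : Rel State 0ℓ
  _⇒⁺_ = TransClosure _─τ→_

  _─[⦅_⦆]→_ : State → Act A → State → Set
  s ─[⦅ a ⦆]→ t = s ─[ a ]→ t ⊎ (a ≡ τ × s ≡ t)

record ProcessGraph (A : Set) : Set₁ where
  field
    lts  : LTS A
    root : LTS.State lts
  open LTS lts public

module _ {A : Set} (L : LTS A) where
  open LTS L

  record IsBranchingBisimulation (R : Rel State 0ℓ) : Set where
    field
      symmetric : Symmetric R
      transfer  : ∀ {s t} → R s t → ∀ {a s′} → s ─[ a ]→ s′ →
                  ∃[ t″ ] ∃[ t′ ] t ⇒ t″ × t″ ─[⦅ a ⦆]→ t′ × R s t″ × R s′ t′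
      accept    : ∀ {s t} → R s t → s ↓ → ∃[ t′ ] t ⇒ t′ × t′ ↓

  IsDivergencePreserving : Rel State 0ℓ → Set
  IsDivergencePreserving R =
    ∀ s t (σ : ℕ → State) → σ 0 ≡ s →
    (∀ i → σ i ─[ τ ]→ σ (suc i)) → (∀ i → R (σ i) t) →
    ∃[ t′ ] t ⇒⁺ t′ × ∃[ i ] R (σ i) t′

  DPBranchingBisimilar : State → State → Set₁
  DPBranchingBisimilar s t =
    Σ[ R ∈ Rel State 0ℓ ]
      IsBranchingBisimulation R × IsDivergencePreserving R × R s t

-- Types have no ambient universe in which to form a union, so a union of two
-- action sets is a jointly surjective pair of injections; actions of A and B
-- count as the same action when they have the same image.
record Union (A B : Set) : Set₁ where
  field
    Carrier : Set
    inl     : A ↣ Carrier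
    inr     : B ↣ Carrier
    cover   : ∀ u → (∃[ a ] Injection.to inl a ≡ u) ⊎ (∃[ b ] Injection.to inr b ≡ u)

relabel : {A B : Set} → A ↣ B → LTS A → LTS B
relabel ι L = record
  { State   = State
  ; _─[_]→_ = λ s b t → ∃[ a ] mapAct (Injection.to ι) a ≡ b × s ─[ a ]→ t
  ; _↓      = _↓
  }
  where open LTS L

disjointUnion : {A : Set} → LTS A → LTS A → LTS A
disjointUnion L M = record
  { State   = L.State ⊎ M.State
  ; _─[_]→_ = λ s a t → Pointwise (λ p q → p L.─[ a ]→ q) (λ p q → p M.─[ a ]→ q) s t
  ; _↓      = [ L._↓ , M._↓ ]
  }
  where
    module L = LTS L
    module M = LTS M

GraphBisimilar : {A B : Set} → Union A B → ProcessGraph A → ProcessGraph B → Set₁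
GraphBisimilar U G H =
  DPBranchingBisimilar
    (disjointUnion (relabel (Union.inl U) G.lts) (relabel (Union.inr U) H.lts))
    (inj₁ G.root) (inj₂ H.root)
  where
    module G = ProcessGraph G
    module H = ProcessGraph H

-- A bag over Fin m is its vector of multiplicities.
Bag : ℕ → Set
Bag m = Vec ℕ m

∅ : ∀ {m} → Bag m
∅ = replicate _ 0

⟅_⟆ : ∀ {m} → Fin m → Bag m
⟅ d ⟆ = ∅ [ d ]≔ 1

infixr 6 _∪_
_∪_ : ∀ {m} → Bag m → Bag m → Bag m
_∪_ = zipWith _+_

infix 4 _∉_
_∉_ : ∀ {m} → Fin m → Bag m → Set
d ∉ x = lookup x d ≡ 0

data Signed (D : Set) : Set where
  plus minus : D → Signed D

-- Finite sets are taken to be of the form Fin k.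
record PPDA : Set where
  field
    #states #inputs #data : ℕ

  Input : Set
  Input = Fin #inputs

  field
    transitions : List (Fin #states × Act Input × Signed (Fin #data) × Bag #data × Fin #states)
    initial     : Fin #states
    accepting   : Subset #states

  infix 4 _─[_[+_/_]]→_ _─[_[-_/_]]→_

  _─[_[+_/_]]→_ : Fin #states → Act Input → Fin #data → Bag #data → Fin #states → Set
  s ─[ a [+ d / x ]]→ t = (s , a , plus d , x , t) List.∈ transitions

  _─[_[-_/_]]→_ : Fin #states → Act Input → Fin #data → Bag #data → Fin #states → Set
  s ─[ a [- d / x ]]→ t = (s , a , minus d , x , t) List.∈ transitions

  Configuration : Set
  Configuration = Fin #states × Bag #data

  data Move : Configuration → Act Input → Configuration → Set where
    present : ∀ {s a d x′ s′ x} → s ─[ a [+ d / x′ ]]→ s′ →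
              Move (s , ⟅ d ⟆ ∪ x) a (s′ , x′ ∪ x)
    absent  : ∀ {s a d x′ s′ x} → d ∉ x → s ─[ a [- d / x′ ]]→ s′ →
              Move (s , x) a (s′ , x′ ∪ x)

  processGraph : ProcessGraph Input
  processGraph = record
    { lts  = record
      { State   = Configuration
      ; _─[_]→_ = Move
      ; _↓      = λ (s , _) → s ∈ accepting
      }
    ; root = initial , ∅
    }

-- a ≺ b: a has lower priority than b.
record PrioritySignature : Set₁ where
  infix 4 _≺_
  field
    Name                 : Set
    _≺_                  : Rel (Act Name) 0ℓ
    isStrictPartialOrder : IsStrictPartialOrder _≡_ _≺_
    τ⊀                   : ∀ a → ¬ (τ ≺ act a)
    ≺⇒≺τ                 : ∀ {a b} → act a ≺ b → act a ≺ τ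

module _ (𝒜 : PrioritySignature) where
  open PrioritySignature 𝒜

  infixr 7 _·_
  infixl 5 _⊕_
  infixl 6 _∥_

  data Expr (n : ℕ) : Set where
    𝟎 𝟏     : Expr n
    _·_     : Act Name → Expr n → Expr n
    _⊕_ _∥_ : Expr n → Expr n → Expr n
    ident   : Fin n → Expr n
    θ       : Expr n → Expr n
    ρ       : (f : Act Name → Act Name) → f τ ≡ τ → Expr n → Expr n

  record Specification : Set where
    field
      #identifiers : ℕ
      definition   : Fin #identifiers → Expr #identifiers
      initial      : Fin #identifiers

-- No constructor for identifiers: these may occur only below a prefix.
data Guarded {𝒜 : PrioritySignature} {n : ℕ} : Expr 𝒜 n → Set where
  𝟎   : Guarded 𝟎
  𝟏   : Guarded 𝟏
  _·_ : ∀ a p → Guarded (a · p)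
  _⊕_ : ∀ {p q} → Guarded p → Guarded q → Guarded (p ⊕ q)
  _∥_ : ∀ {p q} → Guarded p → Guarded q → Guarded (p ∥ q)
  θ   : ∀ {p} → Guarded p → Guarded (θ p)
  ρ   : ∀ f fτ {p} → Guarded p → Guarded (ρ f fτ p)

WeaklyGuarded : {𝒜 : PrioritySignature} → Specification 𝒜 → Set
WeaklyGuarded Γ = ∀ X → Guarded (definition X)
  where open Specification Γ

module Semantics {𝒜 : PrioritySignature} (Γ : Specification 𝒜) where
  open PrioritySignature 𝒜
  open Specification Γ

  Process : Set
  Process = Expr 𝒜 #identifiers

  infix 5 _↓
  data _↓ : Process → Set where
    𝟏↓  : 𝟏 ↓
    ⊕↓ˡ : ∀ {p q} → p ↓ → (p ⊕ q) ↓
    ⊕↓ʳ : ∀ {p q} → q ↓ → (p ⊕ q) ↓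
    ∥↓  : ∀ {p q} → p ↓ → q ↓ → (p ∥ q) ↓
    def↓ : ∀ {X} → definition X ↓ → ident X ↓
    θ↓  : ∀ {p} → p ↓ → θ p ↓
    ρ↓  : ∀ {f fτ p} → p ↓ → ρ f fτ p ↓

  -- The transition rules, where "p has a b-transition" in the negative
  -- premises of the rule for θ is read as En p b.
  data Step (En : Process → Act Name → Set) : Process → Act Name → Process → Set where
    prefix : ∀ {a p} → Step En (a · p) a p
    ⊕ˡ     : ∀ {p q a p′} → Step En p a p′ → Step En (p ⊕ q) a p′
    ⊕ʳ     : ∀ {p q a p′} → Step En p a p′ → Step En (q ⊕ p) a p′
    ∥ˡ     : ∀ {p q a p′} → Step En p a p′ → Step En (p ∥ q) a (p′ ∥ q)
    ∥ʳ     : ∀ {p q a p′} → Step En p a p′ → Step En (q ∥ p) a (q ∥ p′)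
    def    : ∀ {X a p′} → Step En (definition X) a p′ → Step En (ident X) a p′
    θ      : ∀ {p a p′} → Step En p a p′ → (∀ b → a ≺ b → ¬ En p b) →
             Step En (θ p) a (θ p′)
    ρ      : ∀ {f fτ p a p′} → Step En p a p′ → Step En (ρ f fτ p) (f a) (ρ f fτ p′)

  IsTransitionRelation : (Process → Act Name → Process → Set) → Set
  IsTransitionRelation T = ∀ p a q → T p a q ⇔ Step (λ p b → ∃ (T p b)) p a q

  -- The actions enabled in p, by recursion on p, given those of the identifiers.
  enabled : (Fin #identifiers → Act Name → Set) → Process → Act Name → Set
  enabled I 𝟎          a = ⊥
  enabled I 𝟏          a = ⊥
  enabled I (b · p)    a = b ≡ a
  enabled I (p ⊕ q)    a = enabled I p a ⊎ enabled I q a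
  enabled I (p ∥ q)    a = enabled I p a ⊎ enabled I q a
  enabled I (ident X)  a = I X a
  enabled I (θ p)      a = enabled I p a × (∀ b → a ≺ b → ¬ enabled I p b)
  enabled I (ρ f fτ p) a = ∃[ b ] f b ≡ a × enabled I p b

  -- In a weakly guarded specification one unfolding of the identifiers
  -- suffices, so the innermost argument is immaterial.
  Enabled : Process → Act Name → Set
  Enabled = enabled (enabled (λ _ _ → ⊥) ∘ definition)

  -- For weakly guarded Γ this is the transition relation determined by the
  -- rules: see isTransitionRelation and transitionRelation-unique below.
  infix 4 _─[_]→_
  _─[_]→_ : Process → Act Name → Process → Set
  _─[_]→_ = Step Enabled

  processGraph : ProcessGraph Name
  processGraph = record
    { lts  = record { State = Process ; _─[_]→_ = _─[_]→_ ; _↓ = _↓ }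
    ; root = ident initial
    }

  Step-cong : ∀ {E F : Process → Act Name → Set} → (∀ p b → F p b → E p b) →
              ∀ {p a q} → Step E p a q → Step F p a q
  Step-cong h prefix   = prefix
  Step-cong h (⊕ˡ s)   = ⊕ˡ (Step-cong h s)
  Step-cong h (⊕ʳ s)   = ⊕ʳ (Step-cong h s)
  Step-cong h (∥ˡ s)   = ∥ˡ (Step-cong h s)
  Step-cong h (∥ʳ s)   = ∥ʳ (Step-cong h s)
  Step-cong h (def s)  = def (Step-cong h s)
  Step-cong h (θ s n)  = θ (Step-cong h s) (λ b a≺b → n b a≺b ∘ h _ b)
  Step-cong h (ρ s)    = ρ (Step-cong h s)

  private
    open Equivalence using (to; from)

    Names : Set₁
    Names = Fin #identifiers → Act Name → Set

    enabled-guarded : ∀ {I J : Names} {p} → Guarded p → ∀ a → enabled I p a → enabled J p a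
    enabled-guarded 𝟎          a ()
    enabled-guarded 𝟏          a ()
    enabled-guarded (b · p)    a e              = e
    enabled-guarded (g ⊕ h)    a e              = Sum.map (enabled-guarded g a) (enabled-guarded h a) e
    enabled-guarded (g ∥ h)    a e              = Sum.map (enabled-guarded g a) (enabled-guarded h a) e
    enabled-guarded (θ g)      a (e , n)        =
      enabled-guarded g a e , λ b a≺b → n b a≺b ∘ enabled-guarded g b
    enabled-guarded (ρ f fτ g) a (b , fb≡a , e) = b , fb≡a , enabled-guarded g b e

    module Agreement
      (E : Process → Act Name → Set) (I : Names) (OK : Process → Set)
      (⊕-ok : ∀ {p q} → OK (p ⊕ q) → OK p × OK q)
      (∥-ok : ∀ {p q} → OK (p ∥ q) → OK p × OK q)
      (θ-ok : ∀ {p} → OK (θ p) → OK p)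
      (ρ-ok : ∀ {f fτ p} → OK (ρ f fτ p) → OK p)
      (I-ok : ∀ {X} → OK (ident X) → ∀ a → I X a ⇔ ∃ (Step E (definition X) a))
      (E-ok : ∀ {p} → OK p → (∀ a → enabled I p a ⇔ ∃ (Step E p a)) →
              ∀ a → E p a ⇔ enabled I p a)
      where

      agree : ∀ p → OK p → ∀ a → enabled I p a ⇔ ∃ (Step E p a)
      agree 𝟎 ok a = mk⇔ (λ ()) (λ ())
      agree 𝟏 ok a = mk⇔ (λ ()) (λ ())
      agree (b · p) ok a = mk⇔ (λ { refl → p , prefix }) (λ { (_ , prefix) → refl })
      agree (p ⊕ q) ok a with ⊕-ok ok
      ... | okp , okq = mk⇔
        [ map₂ ⊕ˡ ∘ to (agree p okp a) , map₂ ⊕ʳ ∘ to (agree q okq a) ]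
        (λ { (_ , ⊕ˡ s) → inj₁ (from (agree p okp a) (_ , s))
           ; (_ , ⊕ʳ s) → inj₂ (from (agree q okq a) (_ , s)) })
      agree (p ∥ q) ok a with ∥-ok ok
      ... | okp , okq = mk⇔
        [ (λ e → _ , ∥ˡ (proj₂ (to (agree p okp a) e)))
        , (λ e → _ , ∥ʳ (proj₂ (to (agree q okq a) e))) ]
        (λ { (_ , ∥ˡ s) → inj₁ (from (agree p okp a) (_ , s))
           ; (_ , ∥ʳ s) → inj₂ (from (agree q okq a) (_ , s)) })
      agree (ident X) ok a = mk⇔
        (map₂ def ∘ to (I-ok ok a))
        (λ { (_ , def s) → from (I-ok ok a) (_ , s) })
      agree (θ p) ok a = mk⇔
        (λ (e , n) → _ , θ (proj₂ (to (ih a) e)) (λ b a≺b → n b a≺b ∘ to (E≈ b)))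
        (λ { (_ , θ s n) → from (ih a) (_ , s) , λ b a≺b → n b a≺b ∘ from (E≈ b) })
        where
          ih = agree p (θ-ok ok)
          E≈ = E-ok (θ-ok ok) ih
      agree (ρ f fτ p) ok a = mk⇔
        (λ { (b , refl , e) → _ , ρ (proj₂ (to (agree p (ρ-ok ok) b) e)) })
        (λ { (_ , ρ s) → _ , refl , from (agree p (ρ-ok ok) _) (_ , s) })

    agree-guarded : ∀ E I →
      (∀ {p} → Guarded p → (∀ a → enabled I p a ⇔ ∃ (Step E p a)) → ∀ a → E p a ⇔ enabled I p a) →
      ∀ {p} → Guarded p → ∀ a → enabled I p a ⇔ ∃ (Step E p a)
    agree-guarded E I E-ok = Agreement.agree E I Guarded
      (λ { (g ⊕ h) → g , h }) (λ { (g ∥ h) → g , h }) (λ { (θ g) → g }) (λ { (ρ _ _ g) → g })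
      (λ ()) E-ok _

    agree-all : ∀ E I →
      (∀ X a → I X a ⇔ ∃ (Step E (definition X) a)) →
      (∀ p → (∀ a → enabled I p a ⇔ ∃ (Step E p a)) → ∀ a → E p a ⇔ enabled I p a) →
      ∀ p a → enabled I p a ⇔ ∃ (Step E p a)
    agree-all E I I-ok E-ok p = Agreement.agree E I (const ⊤)
      _ _ _ _ (λ {X} _ → I-ok X) (λ {p} _ → E-ok p) p tt

  module _ (wg : WeaklyGuarded Γ) where

    enabled⇔step : ∀ p a → Enabled p a ⇔ ∃ (p ─[ a ]→_)
    enabled⇔step = agree-all Enabled _
      (λ X → agree-guarded Enabled (λ _ _ → ⊥)
        (λ g _ a → mk⇔ (enabled-guarded g a) (enabled-guarded g a)) (wg X))
      (λ p _ a → mk⇔ id id)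

    isTransitionRelation : IsTransitionRelation _─[_]→_
    isTransitionRelation p a q = mk⇔
      (Step-cong (λ r b → from (enabled⇔step r b)))
      (Step-cong (λ r b → to (enabled⇔step r b)))

    transitionRelation-unique : ∀ T → IsTransitionRelation T →
                                ∀ p a q → T p a q ⇔ p ─[ a ]→ q
    transitionRelation-unique T isT p a q = mk⇔
      (Step-cong (λ r b e → map₂ (from (isT r b _)) (to (enabled⇔T r b) e)) ∘ to (isT p a q))
      (from (isT p a q) ∘ Step-cong (λ r b (u , t) → from (enabled⇔T r b) (u , to (isT r b u) t)))
      where
        E : Process → Act Name → Set
        E r b = ∃ (T r b)

        E≈ : ∀ {I : Names} r → (∀ b → enabled I r b ⇔ ∃ (Step E r b)) → ∀ b → E r b ⇔ enabled I r b
        E≈ r ih b = mk⇔ (from (ih b) ∘ map₂ (to (isT r b _))) (map₂ (from (isT r b _)) ∘ to (ih b))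

        enabled⇔T : ∀ r b → Enabled r b ⇔ ∃ (Step E r b)
        enabled⇔T = agree-all E _
          (λ X → agree-guarded E (λ _ _ → ⊥) (λ {r} _ → E≈ r) (wg X))
          E≈

{-# OPTIONS --safe #-}
module Submission where

-- A bag is a parallel composition of one token per datum next to a control
-- process. A token for d performs the +d-transitions under auxiliary visible
-- names, and always offers presence d; the control performs the -d-transitions
-- under names absence d a ≺ presence d, so an inner θ removes exactly those whose
-- datum is present.
--
-- Executing presence d would lose a token, so it may happen only when it is
-- harmless, namely when the automaton is deadlocked. It cannot be forbidden
-- altogether, as without restriction every offered set of actions has an
-- executable maximal element. After renaming presence d to clear and the others
-- to real actions, an outer θ with clear ≺ halt ≺ real lets the control halt only
-- if no automaton transition is possible, and the tokens vanish only after that.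
-- These steps become silent; they are inert and finite in number. Silent
-- transitions of the automaton carry the visible name real τ below both θ's, for
-- otherwise they would block the absence transitions.

open import Defs
open import Data.Bool.Base using (Bool; true; false; if_then_else_)
open import Data.Empty using (⊥; ⊥-elim)
open import Data.Fin.Base using (Fin; zero; suc)
open import Data.Fin.Properties using (_≟_)
open import Data.Fin.Subset using (Subset) renaming (_∈_ to _∈ˢ_)
open import Data.Fin.Subset.Properties using (_∈?_)
open import Data.List.Base using (List; []; _∷_; foldr)
open import Data.List.Membership.Propositional using (_∈_)
open import Data.List.Relation.Unary.Any using (here; there)
open import Data.Nat.Base using (ℕ; zero; suc; _+_)
open import Data.Nat.Properties
  using (+-comm; +-assoc; +-identityˡ; +-cancelˡ-≡; +-suc; suc-injective; m+n≡0⇒m≡0)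
open import Data.Product.Base using (Σ-syntax; ∃; ∃-syntax; _×_; _,_; proj₁; proj₂)
open import Data.Sum.Base using (_⊎_; inj₁; inj₂)
open import Data.Sum.Relation.Binary.Pointwise using (inj₁; inj₂)
open import Data.Vec.Base using ([]; _∷_; lookup)
open import Data.Vec.Properties
  using (zipWith-comm; zipWith-assoc; zipWith-identityˡ; ∷-injective;
         lookup-zipWith; lookup-replicate; lookup∘update; lookup∘update′)
open import Function.Base using (id; _∘_)
open import Function.Bundles using (mk↣; Equivalence)
open import Function.Construct.Identity using (↣-id)
open import Relation.Binary.Construct.Closure.ReflexiveTransitive using (Star; ε; _◅_; gmap)
open import Relation.Binary.Construct.Closure.Transitive using ([_]; _∷_)
open import Relation.Binary.PropositionalEquality
  using (_≡_; refl; sym; trans; cong; cong₂; subst; subst₂; resp₂; isEquivalence;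
         module ≡-Reasoning)
open import Relation.Nullary using (¬_; yes; no; does)

-- Algebra of bags.

module _ {m : ℕ} where

  ∪-comm : (x y : Bag m) → x ∪ y ≡ y ∪ x
  ∪-comm = zipWith-comm +-comm

  ∪-assoc : (x y z : Bag m) → (x ∪ y) ∪ z ≡ x ∪ (y ∪ z)
  ∪-assoc = zipWith-assoc +-assoc

  ∪-identityˡ : (x : Bag m) → ∅ ∪ x ≡ x
  ∪-identityˡ = zipWith-identityˡ +-identityˡ

  ∪-identityʳ : (x : Bag m) → x ∪ ∅ ≡ x
  ∪-identityʳ x = trans (∪-comm x ∅) (∪-identityˡ x)

  ∉-∪ : (d : Fin m) (x y : Bag m) → d ∉ x → d ∉ y → d ∉ x ∪ y
  ∉-∪ d x y d∉x d∉y = trans (lookup-zipWith _+_ d x y) (cong₂ _+_ d∉x d∉y)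

  ∈-⟅⟆∪ : (d : Fin m) (x : Bag m) → ¬ d ∉ ⟅ d ⟆ ∪ x
  ∈-⟅⟆∪ d x d∉ with () ←
    trans (sym (lookup∘update d ∅ 1))
          (m+n≡0⇒m≡0 _ (trans (sym (lookup-zipWith _+_ d ⟅ d ⟆ x)) d∉))

∪-cancelˡ : ∀ {m} (x : Bag m) {y z} → x ∪ y ≡ x ∪ z → y ≡ z
∪-cancelˡ []      {[]}    {[]}    _ = refl
∪-cancelˡ (k ∷ x) {_ ∷ _} {_ ∷ _} e with e₁ , e₂ ← ∷-injective e =
  cong₂ _∷_ (+-cancelˡ-≡ k _ _ e₁) (∪-cancelˡ x e₂)

-- Soups: trees of tokens that represent bags.

-- Shapes of parallel compositions; those of index true have a core as their
-- leftmost component.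
data Soup (m : ℕ) : Bool → Set where
  core : Soup m true
  none : Soup m false
  one  : Fin m → Soup m false
  _∣_  : ∀ {b} → Soup m b → Soup m false → Soup m b

bag : ∀ {m b} → Soup m b → Bag m
bag core    = ∅
bag none    = ∅
bag (one d) = ⟅ d ⟆
bag (t ∣ u) = bag t ∪ bag u

size : ∀ {m b} → Soup m b → ℕ
size core    = 0
size none    = 0
size (one d) = 1
size (t ∣ u) = size t + size u

shift : ∀ {m b} → Soup m b → Soup (suc m) b
shift core    = core
shift none    = none
shift (one d) = one (suc d)
shift (t ∣ u) = shift t ∣ shift u

bag-shift : ∀ {m b} (t : Soup m b) → bag (shift t) ≡ 0 ∷ bag t
bag-shift core    = refl
bag-shift none    = refl
bag-shift (one d) = refl
bag-shift (t ∣ u) = cong₂ _∪_ (bag-shift t) (bag-shift u)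

copies : ∀ {m} → ℕ → Soup (suc m) false
copies zero    = none
copies (suc k) = one zero ∣ copies k

bag-copies : ∀ {m} k → bag (copies {m} k) ≡ k ∷ ∅
bag-copies zero    = refl
bag-copies (suc k) = trans (cong (⟅ zero ⟆ ∪_) (bag-copies k)) (cong (suc k ∷_) (∪-identityˡ ∅))

fromBag : ∀ {m} → Bag m → Soup m false
fromBag []      = none
fromBag (k ∷ x) = copies k ∣ shift (fromBag x)

bag-fromBag : ∀ {m} (x : Bag m) → bag (fromBag x) ≡ x
bag-fromBag []      = refl
bag-fromBag (k ∷ x) =
  trans (cong₂ _∪_ (bag-copies k) (bag-shift (fromBag x)))
        (cong₂ _∷_ (+-comm k 0) (trans (∪-identityˡ _) (bag-fromBag x)))

-- The new tokens go next to the core, since that is where `Control ∥ ⟦ x ⟧` creates them.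
grow : ∀ {m} → Soup m true → Soup m false → Soup m true
grow core    u = core ∣ u
grow (t ∣ v) u = grow t u ∣ v

bag-grow : ∀ {m} (t : Soup m true) u → bag (grow t u) ≡ bag u ∪ bag t
bag-grow core    u = ∪-comm ∅ (bag u)
bag-grow (t ∣ v) u = trans (cong (_∪ bag v) (bag-grow t u)) (∪-assoc (bag u) (bag t) (bag v))

infix 4 _∈ᵗ_
data _∈ᵗ_ {m} (d : Fin m) : ∀ {b} → Soup m b → Set where
  here  : d ∈ᵗ one d
  left  : ∀ {b} {t : Soup m b} {u} → d ∈ᵗ t → d ∈ᵗ t ∣ u
  right : ∀ {b} {t : Soup m b} {u} → d ∈ᵗ u → d ∈ᵗ t ∣ u

module _ {m : ℕ} {d : Fin m} where

  rest : ∀ {b} {t : Soup m b} → d ∈ᵗ t → Bag m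
  rest here              = ∅
  rest (left {u = u} o)  = rest o ∪ bag u
  rest (right {t = t} o) = bag t ∪ rest o

  replace : ∀ {b} {t : Soup m b} → d ∈ᵗ t → Soup m false → Soup m b
  replace here              v = v
  replace (left {u = u} o)  v = replace o v ∣ u
  replace (right {t = t} o) v = t ∣ replace o v

  bag-replace : ∀ {b} {t : Soup m b} (o : d ∈ᵗ t) v → bag (replace o v) ≡ bag v ∪ rest o
  bag-replace here v = sym (∪-identityʳ (bag v))
  bag-replace (left {u = u} o) v =
    trans (cong (_∪ bag u) (bag-replace o v)) (∪-assoc (bag v) (rest o) (bag u))
  bag-replace (right {t = t} o) v = begin
    bag t ∪ bag (replace o v)  ≡⟨ cong (bag t ∪_) (bag-replace o v) ⟩
    bag t ∪ (bag v ∪ rest o)   ≡⟨ ∪-assoc (bag t) (bag v) (rest o) ⟨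
    (bag t ∪ bag v) ∪ rest o   ≡⟨ cong (_∪ rest o) (∪-comm (bag t) (bag v)) ⟩
    (bag v ∪ bag t) ∪ rest o   ≡⟨ ∪-assoc (bag v) (bag t) (rest o) ⟩
    bag v ∪ (bag t ∪ rest o)   ∎
    where open ≡-Reasoning

  -- Makes `bag-∈` the instance of `bag-replace` at `one d`.
  replace-self : ∀ {b} {t : Soup m b} (o : d ∈ᵗ t) → replace o (one d) ≡ t
  replace-self here      = refl
  replace-self (left o)  = cong (_∣ _) (replace-self o)
  replace-self (right o) = cong (_ ∣_) (replace-self o)

  bag-∈ : ∀ {b} {t : Soup m b} (o : d ∈ᵗ t) → bag t ≡ ⟅ d ⟆ ∪ rest o
  bag-∈ o = trans (cong bag (sym (replace-self o))) (bag-replace o (one d))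

  size-remove : ∀ {b} {t : Soup m b} (o : d ∈ᵗ t) → size t ≡ suc (size (replace o none))
  size-remove here              = refl
  size-remove (left {u = u} o)  = cong (_+ size u) (size-remove o)
  size-remove (right {t = t} o) = trans (cong (size t +_) (size-remove o)) (+-suc (size t) _)

  remove-⊆ : ∀ {b} {t : Soup m b} (o : d ∈ᵗ t) {e} → e ∈ᵗ replace o none → e ∈ᵗ t
  remove-⊆ (left o)  (left p)  = left (remove-⊆ o p)
  remove-⊆ (left o)  (right p) = right p
  remove-⊆ (right o) (left p)  = left p
  remove-⊆ (right o) (right p) = right (remove-⊆ o p)

  ∈ᵗ⇒∈ : ∀ {b} {t : Soup m b} → d ∈ᵗ t → ¬ d ∉ bag t
  ∈ᵗ⇒∈ {t = t} o d∉ = ∈-⟅⟆∪ d (rest o) (subst (d ∉_) (bag-∈ o) d∉)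

∈ᵗ-or-∉ : ∀ {m b} (d : Fin m) (t : Soup m b) → d ∈ᵗ t ⊎ d ∉ bag t
∈ᵗ-or-∉ d core = inj₂ (lookup-replicate d 0)
∈ᵗ-or-∉ d none = inj₂ (lookup-replicate d 0)
∈ᵗ-or-∉ d (one e) with d ≟ e
... | yes refl = inj₁ here
... | no d≢e   = inj₂ (trans (lookup∘update′ d≢e ∅ 1) (lookup-replicate d 0))
∈ᵗ-or-∉ d (t ∣ u) with ∈ᵗ-or-∉ d t | ∈ᵗ-or-∉ d u
... | inj₁ o  | _       = inj₁ (left o)
... | inj₂ _  | inj₁ o  = inj₁ (right o)
... | inj₂ ∉t | inj₂ ∉u = inj₂ (∉-∪ d (bag t) (bag u) ∉t ∉u)

-- Turns a `present` move into a token that can perform it; by cancellation the remainder is the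
-- same whichever token for `d` is found.
∈⇒∈ᵗ : ∀ {m b} {d : Fin m} (t : Soup m b) {x} → bag t ≡ ⟅ d ⟆ ∪ x → Σ[ o ∈ d ∈ᵗ t ] rest o ≡ x
∈⇒∈ᵗ {d = d} t {x} eq with ∈ᵗ-or-∉ d t
... | inj₁ o = o , ∪-cancelˡ ⟅ d ⟆ (trans (sym (bag-∈ o)) eq)
... | inj₂ ∉t = ⊥-elim (∈-⟅⟆∪ d x (subst (d ∉_) eq ∉t))

-- Names and priorities.

module Labels (#inputs #data : ℕ) where

  data Label : Set where
    real     : Act (Fin #inputs) → Label
    absence  : Fin #data → Act (Fin #inputs) → Label
    presence : Fin #data → Label
    halt     : Label
    clear    : Label

  infix 4 _≺_
  -- One ordering serves both θ's: `presence d` lies only above `absence d a`, while `clear`, its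
  -- name after the inner θ, is the bottom of the other chain. The pairs with τ are forced by
  -- `≺⇒≺τ`.
  data _≺_ : Act Label → Act Label → Set where
    absence≺presence : ∀ {d a} → act (absence d a) ≺ act (presence d)
    absence≺τ        : ∀ {d a} → act (absence d a) ≺ τ
    clear≺halt       : act clear ≺ act halt
    clear≺real       : ∀ {a} → act clear ≺ act (real a)
    clear≺τ          : act clear ≺ τ
    halt≺real        : ∀ {a} → act halt ≺ act (real a)
    halt≺τ           : act halt ≺ τ

  ≺-irrefl : ∀ {a b} → a ≡ b → ¬ a ≺ b
  ≺-irrefl refl ()

  ≺-trans : ∀ {a b c} → a ≺ b → b ≺ c → a ≺ c
  ≺-trans clear≺halt halt≺real = clear≺real
  ≺-trans clear≺halt halt≺τ    = clear≺τ

  ≺⇒≺τ : ∀ {a b} → act a ≺ b → act a ≺ τ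
  ≺⇒≺τ absence≺presence = absence≺τ
  ≺⇒≺τ absence≺τ        = absence≺τ
  ≺⇒≺τ clear≺halt       = clear≺τ
  ≺⇒≺τ clear≺real       = clear≺τ
  ≺⇒≺τ clear≺τ          = clear≺τ
  ≺⇒≺τ halt≺real        = halt≺τ
  ≺⇒≺τ halt≺τ           = halt≺τ

  signature : PrioritySignature
  signature = record
    { Name                 = Label
    ; _≺_                  = _≺_
    ; isStrictPartialOrder = record
      { isEquivalence = isEquivalence
      ; irrefl        = ≺-irrefl
      ; trans         = ≺-trans
      ; <-resp-≈      = resp₂ _≺_
      }
    ; τ⊀                   = λ _ ()
    ; ≺⇒≺τ                 = ≺⇒≺τ
    }

  visible : Fin #inputs → Label
  visible i = real (act i)

  visible-injective : ∀ {i j} → visible i ≡ visible j → i ≡ j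
  visible-injective refl = refl

  expose : Act Label → Act Label
  expose (act (absence d a)) = act (real a)
  expose (act (presence d))  = act clear
  expose a                   = a

  conceal : Act Label → Act Label
  conceal (act (real a)) = mapAct visible a
  -- Meant for `halt` and `clear`: no `absence` or `presence` is left after `expose`.
  conceal _              = τ

-- The specification.

module Encoding (#inputs #data : ℕ)
  (transitions : List (Fin 1 × Act (Fin #inputs) × Signed (Fin #data) × Bag #data × Fin 1))
  (accepting : Subset 1)
  where

  open Labels #inputs #data

  M : PPDA
  M = record
    { #states = 1 ; #inputs = #inputs ; #data = #data
    ; transitions = transitions ; initial = zero ; accepting = accepting }

  open PPDA M using (Configuration; Move; present; absent)

  Transition : Set
  Transition = Fin 1 × Act (Fin #inputs) × Signed (Fin #data) × Bag #data × Fin 1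

  Term : Set
  Term = Expr signature (suc (suc #data))

  Start Control : Term
  Start   = ident zero
  Control = ident (suc zero)

  Token : Fin #data → Term
  Token d = ident (suc (suc d))

  -- The process at the core is a parameter because it changes: `Control` at first,
  -- `Control ∥ ⟦ x ⟧` right after an absence step, `verdict` after halting.
  term : ∀ {b} → Term → Soup #data b → Term
  term B core    = B
  term B none    = 𝟏
  term B (one d) = Token d
  term B (t ∣ u) = term B t ∥ term B u

  -- `𝟎` is a dummy, as `fromBag x` has no core; see `term-coreless`.
  ⟦_⟧ : Bag #data → Term
  ⟦ x ⟧ = term 𝟎 (fromBag x)

  term-coreless : ∀ B B′ (t : Soup #data false) → term B t ≡ term B′ t
  term-coreless B B′ none    = refl
  term-coreless B B′ (one d) = refl
  term-coreless B B′ (t ∣ u) = cong₂ _∥_ (term-coreless B B′ t) (term-coreless B B′ u)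

  -- Restores the form `term Control t` after an absence step, by absorbing the tokens created at
  -- the core into the soup.
  term-grow : ∀ {B} (t : Soup #data true) u → term (B ∥ term 𝟎 u) t ≡ term B (grow t u)
  term-grow {B} core    u = cong (B ∥_) (term-coreless 𝟎 B u)
  term-grow {B} (t ∣ v) u = cong₂ _∥_ (term-grow t u) (term-coreless _ B v)

  -- The renaming between the two θ's is needed because with a single one
  -- halt ≺ absence d a ≺ presence d would let a token block halting.
  screened context : Term → Term
  screened p = ρ expose refl (θ p)
  context p  = ρ conceal refl (θ (screened p))

  -- Tokens always accept, so the core alone decides acceptance; `verdict` does so both as a summand
  -- of `Control` and after halting.
  verdict : Term
  verdict = if does (zero ∈? accepting) then 𝟏 else 𝟎

  choice : (Transition → Term) → List Transition → Term
  choice f = foldr (λ r p → f r ⊕ p) 𝟎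

  onPresence : Fin #data → Transition → Term
  onPresence d (_ , a , plus e , x , _)  = if does (d ≟ e) then act (real a) · ⟦ x ⟧ else 𝟎
  onPresence d (_ , a , minus e , x , _) = 𝟎

  onAbsence : Transition → Term
  onAbsence (_ , a , plus d , x , _)  = 𝟎
  onAbsence (_ , a , minus d , x , _) = act (absence d a) · (Control ∥ ⟦ x ⟧)

  equation : Fin (suc (suc #data)) → Term
  -- The initial silent step avoids having to unfold Control for guardedness.
  equation zero          = τ · context Control
  equation (suc zero)    = choice onAbsence transitions ⊕ act halt · verdict ⊕ verdict
  equation (suc (suc d)) = choice (onPresence d) transitions ⊕ act (presence d) · 𝟏 ⊕ 𝟏

  Γ : Specification signature
  Γ = record { #identifiers = suc (suc #data) ; definition = equation ; initial = zero }

  open Semantics Γ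
  open LTS (ProcessGraph.lts processGraph) using (_─τ→_)

  -- Weak guardedness and enabled actions.

  verdict-guarded : Guarded verdict
  verdict-guarded with does (zero ∈? accepting)
  ... | true  = 𝟏
  ... | false = 𝟎

  choice-guarded : ∀ {f} → (∀ r → Guarded (f r)) → ∀ rs → Guarded (choice f rs)
  choice-guarded g []       = 𝟎
  choice-guarded g (r ∷ rs) = g r ⊕ choice-guarded g rs

  onPresence-guarded : ∀ d r → Guarded (onPresence d r)
  onPresence-guarded d (_ , a , plus e , x , _) with does (d ≟ e)
  ... | true  = act (real a) · ⟦ x ⟧
  ... | false = 𝟎
  onPresence-guarded d (_ , a , minus e , x , _) = 𝟎

  onAbsence-guarded : ∀ r → Guarded (onAbsence r)
  onAbsence-guarded (_ , a , plus d , x , _)  = 𝟎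
  onAbsence-guarded (_ , a , minus d , x , _) = _ · _

  weaklyGuarded : WeaklyGuarded Γ
  weaklyGuarded zero          = _ · _
  weaklyGuarded (suc zero)    =
    choice-guarded onAbsence-guarded transitions ⊕ _ · _ ⊕ verdict-guarded
  weaklyGuarded (suc (suc d)) =
    choice-guarded (onPresence-guarded d) transitions ⊕ _ · _ ⊕ 𝟏

  step⇒enabled : ∀ {p a q} → p ─[ a ]→ q → Enabled p a
  step⇒enabled s = Equivalence.from (enabled⇔step weaklyGuarded _ _) (_ , s)

  enabled⇒step : ∀ p {a} → Enabled p a → ∃ (p ─[ a ]→_)
  enabled⇒step p = Equivalence.to (enabled⇔step weaklyGuarded p _)

  -- Steps and acceptance of the components.

  verdict-stuck : ∀ {a q} → ¬ verdict ─[ a ]→ q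
  verdict-stuck s with does (zero ∈? accepting)
  verdict-stuck () | true
  verdict-stuck () | false

  verdict↓⇒ : verdict ↓ → zero ∈ˢ accepting
  verdict↓⇒ v with zero ∈? accepting
  ... | yes acc = acc
  verdict↓⇒ () | no _

  ⇒verdict↓ : zero ∈ˢ accepting → verdict ↓
  ⇒verdict↓ acc with zero ∈? accepting
  ... | yes _   = 𝟏↓
  ... | no ¬acc = ⊥-elim (¬acc acc)

  choice-step⁺ : ∀ {f r rs a q} → r ∈ rs → f r ─[ a ]→ q → choice f rs ─[ a ]→ q
  choice-step⁺ (here refl) s = ⊕ˡ s
  choice-step⁺ (there r∈)  s = ⊕ʳ (choice-step⁺ r∈ s)

  choice-step⁻ : ∀ {f} rs {a q} → choice f rs ─[ a ]→ q → ∃[ r ] r ∈ rs × f r ─[ a ]→ q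
  choice-step⁻ (r ∷ rs) (⊕ˡ s) = r , here refl , s
  choice-step⁻ (r ∷ rs) (⊕ʳ s) with r′ , r′∈ , s′ ← choice-step⁻ rs s = r′ , there r′∈ , s′

  choice-↓⁻ : ∀ {f} rs → choice f rs ↓ → ∃[ r ] f r ↓
  choice-↓⁻ (r ∷ rs) (⊕↓ˡ p) = r , p
  choice-↓⁻ (r ∷ rs) (⊕↓ʳ p) = choice-↓⁻ rs p

  -- The target is given as a soup, so that `replace` can put it in the place of the token.
  data TokenStep (d : Fin #data) : Act Label → Soup #data false → Set where
    consume : ∀ {a x} → (zero , a , plus d , x , zero) ∈ transitions →
              TokenStep d (act (real a)) (fromBag x)
    vanish  : TokenStep d (act (presence d)) none

  onPresence-step⁺ : ∀ d {a x} →
                     onPresence d (zero , a , plus d , x , zero) ─[ act (real a) ]→ ⟦ x ⟧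
  onPresence-step⁺ d with d ≟ d
  ... | yes _   = prefix
  ... | no d≢d  = ⊥-elim (d≢d refl)

  onPresence-step⁻ : ∀ {d} r {a q} → r ∈ transitions → onPresence d r ─[ a ]→ q →
                     ∃[ v ] TokenStep d a v × q ≡ term 𝟎 v
  onPresence-step⁻ {d} (zero , a , plus e , x , zero) r∈ s with d ≟ e
  onPresence-step⁻ {d} (zero , a , plus e , x , zero) r∈ prefix | yes refl = _ , consume r∈ , refl
  onPresence-step⁻ {d} (zero , a , plus e , x , zero) r∈ () | no _

  token-step⁺ : ∀ {B d a v} → TokenStep d a v → Token d ─[ a ]→ term B v
  token-step⁺ {B} {d} {v = v} s = subst (Token d ─[ _ ]→_) (term-coreless 𝟎 B v) (go s)
    where
    go : ∀ {a v} → TokenStep d a v → Token d ─[ a ]→ term 𝟎 v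
    go (consume r∈) = def (⊕ˡ (⊕ˡ (choice-step⁺ r∈ (onPresence-step⁺ d))))
    go vanish       = def (⊕ˡ (⊕ʳ prefix))

  token-step⁻ : ∀ {d a q} → Token d ─[ a ]→ q → ∃[ v ] TokenStep d a v × q ≡ term 𝟎 v
  token-step⁻ (def (⊕ˡ (⊕ˡ s))) with r , r∈ , s′ ← choice-step⁻ transitions s =
    onPresence-step⁻ r r∈ s′
  token-step⁻ (def (⊕ˡ (⊕ʳ prefix))) = _ , vanish , refl

  data ControlStep : Act Label → Term → Set where
    extend : ∀ {a d x} → (zero , a , minus d , x , zero) ∈ transitions →
             ControlStep (act (absence d a)) (Control ∥ ⟦ x ⟧)
    stop   : ControlStep (act halt) verdict

  onAbsence-step⁻ : ∀ r {a q} → r ∈ transitions → onAbsence r ─[ a ]→ q → ControlStep a q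
  onAbsence-step⁻ (zero , _ , minus _ , _ , zero) r∈ prefix = extend r∈

  control-step⁺ : ∀ {a q} → ControlStep a q → Control ─[ a ]→ q
  control-step⁺ (extend r∈) = def (⊕ˡ (⊕ˡ (choice-step⁺ r∈ prefix)))
  control-step⁺ stop        = def (⊕ˡ (⊕ʳ prefix))

  control-step⁻ : ∀ {a q} → Control ─[ a ]→ q → ControlStep a q
  control-step⁻ (def (⊕ˡ (⊕ˡ s))) with r , r∈ , s′ ← choice-step⁻ transitions s =
    onAbsence-step⁻ r r∈ s′
  control-step⁻ (def (⊕ˡ (⊕ʳ prefix))) = stop
  control-step⁻ (def (⊕ʳ s)) = ⊥-elim (verdict-stuck s)

  control↓⇒ : Control ↓ → verdict ↓
  control↓⇒ (def↓ (⊕↓ˡ (⊕↓ˡ c))) with choice-↓⁻ transitions c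
  ... | (_ , _ , plus _ , _ , _) , ()
  ... | (_ , _ , minus _ , _ , _) , ()
  control↓⇒ (def↓ (⊕↓ʳ v)) = v

  term↓⇒ : ∀ {B} (t : Soup #data true) → term B t ↓ → B ↓
  term↓⇒ core    p        = p
  term↓⇒ (t ∣ u) (∥↓ p _) = term↓⇒ t p

  ⇒term↓ : ∀ {B b} → B ↓ → (t : Soup #data b) → term B t ↓
  ⇒term↓ p core    = p
  ⇒term↓ p none    = 𝟏↓
  ⇒term↓ p (one d) = def↓ (⊕↓ʳ 𝟏↓)
  ⇒term↓ p (t ∣ u) = ∥↓ (⇒term↓ p t) (⇒term↓ p u)

  context↓⇒ : ∀ {p} → context p ↓ → p ↓
  context↓⇒ (ρ↓ (θ↓ (ρ↓ (θ↓ p)))) = p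

  ⇒context↓ : ∀ {p} → p ↓ → context p ↓
  ⇒context↓ p = ρ↓ (θ↓ (ρ↓ (θ↓ p)))

  -- Steps of parallel compositions.

  data TermStep (B : Term) : ∀ {b} → Soup #data b → Act Label → Term → Set where
    byCore  : ∀ {t a B′} → B ─[ a ]→ B′ → TermStep B {true} t a (term B′ t)
    byToken : ∀ {b} {t : Soup #data b} {d a v} (o : d ∈ᵗ t) → TokenStep d a v →
              TermStep B t a (term B (replace o v))

  core-step⁺ : ∀ {B B′ a} → B ─[ a ]→ B′ → (t : Soup #data true) → term B t ─[ a ]→ term B′ t
  core-step⁺ s core = s
  core-step⁺ {B} {B′} s (t ∣ u) =
    subst (λ r → _ ─[ _ ]→ term B′ t ∥ r) (term-coreless B B′ u) (∥ˡ (core-step⁺ s t))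

  occurrence-step⁺ : ∀ {B b} {t : Soup #data b} {d a v} (o : d ∈ᵗ t) →
                     TokenStep d a v → term B t ─[ a ]→ term B (replace o v)
  occurrence-step⁺ here      s = token-step⁺ s
  occurrence-step⁺ (left o)  s = ∥ˡ (occurrence-step⁺ o s)
  occurrence-step⁺ (right o) s = ∥ʳ (occurrence-step⁺ o s)

  term-step⁻ : ∀ {B b} (t : Soup #data b) {a q} → term B t ─[ a ]→ q → TermStep B t a q
  term-step⁻ core s = byCore s
  term-step⁻ {B} (one d) s with v , s′ , refl ← token-step⁻ s =
    subst (TermStep B (one d) _) (term-coreless B 𝟎 v) (byToken here s′)
  term-step⁻ {B} (t ∣ u) (∥ˡ s) with term-step⁻ t s
  ... | byCore {B′ = B′} s′ =
    subst (λ r → TermStep B (t ∣ u) _ (term B′ t ∥ r)) (term-coreless B′ B u) (byCore s′)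
  ... | byToken o s′ = byToken (left o) s′
  term-step⁻ (t ∣ u) (∥ʳ s) with term-step⁻ u s
  ... | byToken o s′ = byToken (right o) s′

  -- Silent moves are still named `real τ` at this level. Hence the priority that τ has over
  -- `absence` and `halt` never takes effect.
  no-τ : ∀ (t : Soup #data true) {q} → ¬ term Control t ─[ τ ]→ q
  no-τ t s with term-step⁻ t s
  ... | byToken _ ()
  ... | byCore s′ with () ← control-step⁻ s′

  presence-step⁻ : ∀ (t : Soup #data true) {d q} →
                   term Control t ─[ act (presence d) ]→ q → d ∈ᵗ t
  presence-step⁻ t s with term-step⁻ t s
  ... | byToken o vanish = o
  ... | byCore s′ with () ← control-step⁻ s′

  -- Names `real a` are maximal for `≺`, so θ never blocks them.
  screened-real : ∀ {p a q} → p ─[ act (real a) ]→ q → screened p ─[ act (real a) ]→ screened q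
  screened-real s = ρ (θ s (λ _ ()))

  context-real : ∀ {p a q} → screened p ─[ act (real a) ]→ screened q →
                 context p ─[ mapAct visible a ]→ context q
  context-real s = ρ (θ s (λ _ ()))

  -- Automaton moves and steps of soups.

  consume-bag : ∀ {b} {t : Soup #data b} {d} (o : d ∈ᵗ t) x → bag (replace o (fromBag x)) ≡ x ∪ rest o
  consume-bag o x = trans (bag-replace o (fromBag x)) (cong (_∪ rest o) (bag-fromBag x))

  extend-bag : ∀ (t : Soup #data true) x → bag (grow t (fromBag x)) ≡ x ∪ bag t
  extend-bag t x = trans (bag-grow t (fromBag x)) (cong (_∪ bag t) (bag-fromBag x))

  consume-move : ∀ {b} {t : Soup #data b} {d a x} (o : d ∈ᵗ t) →
                 (zero , a , plus d , x , zero) ∈ transitions →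
                 Move (zero , bag t) a (zero , bag (replace o (fromBag x)))
  consume-move {a = a} {x} o r∈ =
    subst₂ (λ y z → Move (zero , y) a (zero , z)) (sym (bag-∈ o)) (sym (consume-bag o x)) (present r∈)

  extend-move : ∀ (t : Soup #data true) {d a x} → d ∉ bag t →
                (zero , a , minus d , x , zero) ∈ transitions →
                Move (zero , bag t) a (zero , bag (grow t (fromBag x)))
  extend-move t {a = a} {x} d∉ r∈ =
    subst (λ z → Move (zero , bag t) a (zero , z)) (sym (extend-bag t x)) (absent d∉ r∈)

  -- Stated below the outer θ to serve twice: `context-real` lifts the step to an answer in
  -- `answer`, and in `progress` the step contradicts the outer premise that lets `halt` through.
  simulate : ∀ (t : Soup #data true) {x a y} → bag t ≡ x → Move (zero , x) a (zero , y) →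
             ∃[ t′ ] bag t′ ≡ y ×
             screened (term Control t) ─[ act (real a) ]→ screened (term Control t′)
  simulate t eq (present {x′ = x′} r∈) with o , refl ← ∈⇒∈ᵗ t eq =
    replace o (fromBag x′) , consume-bag o x′ , screened-real (occurrence-step⁺ o (consume r∈))
  simulate t refl (absent {a = a} {d} {x′} d∉ r∈) =
    grow t (fromBag x′) , extend-bag t x′ ,
    subst (λ r → _ ─[ _ ]→ screened r) (term-grow t (fromBag x′))
          (ρ (θ (core-step⁺ (control-step⁺ (extend r∈)) t) unblocked))
    where
    unblocked : ∀ b → act (absence d a) ≺ b → ¬ Enabled (term Control t) b
    unblocked _ absence≺presence e = ∈ᵗ⇒∈ (presence-step⁻ t (proj₂ (enabled⇒step (term Control t) e))) d∉
    unblocked _ absence≺τ        e = no-τ t (proj₂ (enabled⇒step (term Control t) e))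

  -- The relation between configurations and terms.

  Stuck : Configuration → Set
  Stuck c = ∀ {a c′} → ¬ Move c a c′

  Barren : ∀ {b} → Soup #data b → Set
  Barren t = ∀ {d a x} → d ∈ᵗ t → ¬ (zero , a , plus d , x , zero) ∈ transitions

  infix 4 _~_
  -- In `dead` the bag of `t` is not tied to `c`: tokens vanish while the automaton stays where it
  -- got stuck. So `Barren t` is carried along separately.
  data _~_ : Configuration → Term → Set where
    start : (zero , ∅) ~ Start
    live  : ∀ (t : Soup #data true) {x} → bag t ≡ x → (zero , x) ~ context (term Control t)
    dead  : ∀ (t : Soup #data true) {c} → Stuck c → Barren t → c ~ context (term verdict t)

  -- Bounds the number of consecutive inert steps.
  weight : ∀ {c p} → c ~ p → ℕ
  weight start        = 2
  weight (live t _)   = suc (size t)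
  weight (dead t _ _) = size t

  -- Every inert step lowers the weight by exactly one: unfolding `Start` goes from 2 to 1, halting
  -- drops the `suc`, and each vanishing token lowers the size.
  data Progress (c : Configuration) (n : ℕ) : Act Label → Term → Set where
    move  : ∀ {a c′ p} → Move c a c′ → c′ ~ p → Progress c n (mapAct visible a) p
    inert : ∀ {p} (r : c ~ p) → suc (weight r) ≡ n → Progress c n τ p

  progress : ∀ {c p b p′} (r : c ~ p) → p ─[ b ]→ p′ → Progress c (weight r) b p′
  progress start (def prefix) = inert (live core refl) refl
  progress (live t refl) (ρ (θ (ρ (θ s n)) n′)) with term-step⁻ t s
  ... | byToken o (consume r∈) = move (consume-move o r∈) (live _ refl)
  -- If `clear` passes the outer θ, no `real` name is enabled there, hence none inside either. Then
  -- `halt` passes the inner θ and blocks `clear`, a contradiction.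
  ... | byToken o vanish = ⊥-elim (n′ _ clear≺halt (step⇒enabled halting))
    where
    unblocked : ∀ b → act halt ≺ b → ¬ Enabled (term Control t) b
    unblocked _ halt≺real e =
      n′ _ clear≺real (step⇒enabled (screened-real (proj₂ (enabled⇒step (term Control t) e))))
    unblocked _ halt≺τ    e = no-τ t (proj₂ (enabled⇒step (term Control t) e))

    halting : screened (term Control t) ─[ act halt ]→ screened (term verdict t)
    halting = ρ (θ (core-step⁺ (control-step⁺ stop) t) unblocked)
  ... | byCore s′ with control-step⁻ s′
  -- `halt` has passed the outer θ, so no `real` name is enabled; by `simulate` the automaton has no
  -- move, and no token can be consumed.
  ...   | stop = inert (dead t stuck (λ o r∈ → stuck (consume-move o r∈))) refl
    where
    stuck : Stuck (zero , bag t)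
    stuck {c′ = zero , _} mv =
      n′ _ halt≺real (step⇒enabled (proj₂ (proj₂ (simulate t refl mv))))
  ...   | extend {d = d} {x} r∈ with ∈ᵗ-or-∉ d t
  -- A token for `d` offers `presence d`, so the inner θ would have blocked this step.
  ...     | inj₁ o = ⊥-elim (n _ absence≺presence (step⇒enabled (occurrence-step⁺ o vanish)))
  ...     | inj₂ d∉ = move (extend-move t d∉ r∈)
    (subst (λ r → (zero , bag (grow t (fromBag x))) ~ context r) (sym (term-grow t (fromBag x)))
           (live _ refl))
  progress (dead t stuck barren) (ρ (θ (ρ (θ s _)) _)) with term-step⁻ t s
  ... | byCore s′              = ⊥-elim (verdict-stuck s′)
  ... | byToken o (consume r∈) = ⊥-elim (barren o r∈)
  ... | byToken o vanish       =
    inert (dead (replace o none) stuck (barren ∘ remove-⊆ o)) (sym (size-remove o))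

  -- Only `start` needs a silent step first; `live` answers at once, and `dead` has no move to
  -- answer.
  answer : ∀ {c p a c′} → c ~ p → Move c a c′ →
           ∃[ p″ ] ∃[ p′ ] Star _─τ→_ p p″ × p″ ─[ mapAct visible a ]→ p′ × c ~ p″ × c′ ~ p′
  answer {c′ = zero , _} start mv with t , eq , s ← simulate core refl mv =
    _ , _ , def prefix ◅ ε , context-real s , live core refl , live t eq
  answer {c′ = zero , _} (live t eq) mv with t′ , eq′ , s ← simulate t eq mv =
    _ , _ , ε , context-real s , live t eq , live t′ eq′
  answer (dead t stuck _) mv = ⊥-elim (stuck mv)

  accept⇒ : ∀ {c p} → c ~ p → proj₁ c ∈ˢ accepting → ∃[ p′ ] Star _─τ→_ p p′ × p′ ↓
  accept⇒ start acc = _ , def prefix ◅ ε , ⇒context↓ (def↓ (⊕↓ʳ (⇒verdict↓ acc)))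
  accept⇒ (live t _) acc = _ , ε , ⇒context↓ (⇒term↓ (def↓ (⊕↓ʳ (⇒verdict↓ acc))) t)
  accept⇒ (dead t {zero , _} _ _) acc = _ , ε , ⇒context↓ (⇒term↓ (⇒verdict↓ acc) t)

  accept⇐ : ∀ {c p} → c ~ p → p ↓ → proj₁ c ∈ˢ accepting
  accept⇐ start (def↓ ())
  accept⇐ (live t _) p = verdict↓⇒ (control↓⇒ (term↓⇒ t (context↓⇒ p)))
  accept⇐ (dead t {zero , _} _ _) p = verdict↓⇒ (term↓⇒ t (context↓⇒ p))

  -- The bisimulation on the disjoint union.

  -- Input `i` is identified with the name `real (act i)`, so `Label` itself is the union.
  labels : Union (Fin #inputs) Label
  labels = record
    { Carrier = Label
    ; inl     = mk↣ {to = visible} visible-injective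
    ; inr     = ↣-id Label
    ; cover   = λ u → inj₂ (u , refl)
    }

  system : LTS Label
  system = disjointUnion
    (relabel (Union.inl labels) (ProcessGraph.lts (PPDA.processGraph M)))
    (relabel (Union.inr labels) (ProcessGraph.lts processGraph))

  module W = LTS system

  mapAct-id : ∀ {A : Set} (a : Act A) → mapAct id a ≡ a
  mapAct-id τ       = refl
  mapAct-id (act _) = refl

  lift : ∀ {p a q} → p ─[ a ]→ q → inj₂ p W.─[ a ]→ inj₂ q
  lift s = inj₂ (_ , mapAct-id _ , s)

  unlift : ∀ {p a q} → inj₂ p W.─[ a ]→ inj₂ q → p ─[ a ]→ q
  unlift (inj₂ (a , refl , s)) = subst (λ b → _ ─[ b ]→ _) (sym (mapAct-id a)) s

  lift⋆ : ∀ {p q} → Star _─τ→_ p q → inj₂ p W.⇒ inj₂ q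
  lift⋆ = gmap inj₂ lift

  R : W.State → W.State → Set
  R (inj₁ c) (inj₂ p) = c ~ p
  R (inj₂ p) (inj₁ c) = c ~ p
  R _        _        = ⊥

  R-symmetric : ∀ {s t} → R s t → R t s
  R-symmetric {inj₁ _} {inj₂ _} r = r
  R-symmetric {inj₂ _} {inj₁ _} r = r

  R-transfer : ∀ {s t} → R s t → ∀ {a s′} → s W.─[ a ]→ s′ →
               ∃[ t″ ] ∃[ t′ ] t W.⇒ t″ × t″ W.─[⦅ a ⦆]→ t′ × R s t″ × R s′ t′
  R-transfer {inj₁ _} {inj₂ _} r (inj₁ (_ , refl , mv))
    with _ , _ , p⇒p″ , s , r″ , r′ ← answer r mv =
    _ , _ , lift⋆ p⇒p″ , inj₁ (lift s) , r″ , r′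
  R-transfer {inj₂ _} {inj₁ _} r {s′ = inj₂ _} s with progress r (unlift s)
  ... | move {a} mv r′ = _ , _ , ε , inj₁ (inj₁ (a , refl , mv)) , r , r′
  ... | inert r′ _     = _ , _ , ε , inj₂ (refl , refl) , r , r′

  R-accept : ∀ {s t} → R s t → s W.↓ → ∃[ t′ ] t W.⇒ t′ × t′ W.↓
  R-accept {inj₁ _} {inj₂ _} r acc with _ , p⇒p′ , p′↓ ← accept⇒ r acc = _ , lift⋆ p⇒p′ , p′↓
  R-accept {inj₂ _} {inj₁ _} r p↓ = _ , ε , accept⇐ r p↓

  -- Preservation of divergence.

  R-weight : ∀ s t → R s t → ℕ
  R-weight (inj₁ _) (inj₂ _) r = weight r
  R-weight (inj₂ _) (inj₁ _) r = weight r

  infixr 5 _◅⁺_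
  _◅⁺_ : ∀ {s t u} → s W.⇒ t → t W.─τ→ u → s W.⇒⁺ u
  ε         ◅⁺ s = [ s ]
  (s′ ◅ ss) ◅⁺ s = s′ ∷ (ss ◅⁺ s)

  respond : ∀ s {s′ t} (r : R s t) → s W.─τ→ s′ →
            (∃[ t′ ] t W.⇒⁺ t′ × R s′ t′) ⊎
            (Σ[ r′ ∈ R s′ t ] suc (R-weight s′ t r′) ≡ R-weight s t r)
  respond (inj₁ _) {t = inj₂ _} r (inj₁ (τ , refl , mv))
    with _ , _ , p⇒p″ , s , _ , r′ ← answer r mv = inj₁ (_ , lift⋆ p⇒p″ ◅⁺ lift s , r′)
  -- The label is generalised so that `move` can be matched; `mapAct visible a ≡ τ` then forces `a`
  -- to be τ.
  respond (inj₂ _) {inj₂ _} {inj₁ _} r s = view (progress r (unlift s)) refl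
    where
    view : ∀ {c n a p} → Progress c n a p → a ≡ τ →
           (∃[ t′ ] inj₁ c W.⇒⁺ t′ × R (inj₂ p) t′) ⊎ (Σ[ r′ ∈ c ~ p ] suc (weight r′) ≡ n)
    view (move {τ} mv r′) refl = inj₁ (_ , [ inj₁ (τ , refl , mv) ] , r′)
    view (inert r′ eq)    refl = inj₂ (r′ , eq)

  -- A step of `σ` that `t` does not match with a silent step of its own lowers the weight, so
  -- `search`, by induction on the weight, reaches a matched step.
  R-divergence : IsDivergencePreserving system R
  R-divergence _ t σ _ steps related = search 0 (related 0) refl
    where
    search : ∀ {n} i (r : R (σ i) t) → R-weight (σ i) t r ≡ n →
             ∃[ t′ ] t W.⇒⁺ t′ × ∃[ j ] R (σ j) t′
    search i r eq with respond (σ i) r (steps i)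
    search i r eq         | inj₁ (t′ , t⇒⁺t′ , r′) = t′ , t⇒⁺t′ , suc i , r′
    search {suc n} i r eq | inj₂ (r′ , eq′) = search {n} (suc i) r′ (suc-injective (trans eq′ eq))
    search {zero} i r eq  | inj₂ (r′ , eq′) with () ← trans eq′ eq

  bisimilar : GraphBisimilar labels (PPDA.processGraph M) processGraph
  bisimilar = R ,
    record { symmetric = λ {s} → R-symmetric {s} ; transfer = R-transfer ; accept = R-accept } ,
    R-divergence , start

theorem8 : (M : PPDA) → PPDA.#states M ≡ 1 →
    Σ[ 𝒜 ∈ PrioritySignature ] Σ[ Γ ∈ Specification 𝒜 ] WeaklyGuarded Γ ×
    (Σ[ U ∈ Union (PPDA.Input M) (PrioritySignature.Name 𝒜) ]
    GraphBisimilar U (PPDA.processGraph M) (Semantics.processGraph Γ))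
theorem8 record { #inputs = #inputs ; #data = #data ; transitions = transitions
                ; initial = zero ; accepting = accepting } refl =
  Labels.signature #inputs #data , Γ , weaklyGuarded , labels , bisimilar
  where open Encoding #inputs #data transitions accepting
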